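{- A functional $\Theta$ satisfying $\textsf{SFF}(\Theta)$ can be computed from $\exists^3$.
   Context: The metatheory is $\textsf{ZFC}$ and functionals live in the full (set-theoretic) type structure over $\mathbb{N}$. "Computable" (in given functionals) means Kleene computable via the schemes S1–S9. For $f\in\mathbb{N}^{\mathbb{N}}$, $\overline{f}N=\langle f(0),\dots,f(N-1)\rangle$; for a finite sequence $\sigma$, $f\in[\sigma]$ means $f$ extends $\sigma$. A functional $\Theta$ of type $2\to1^*$ assigns to every $G:\mathbb{N}^{\mathbb{N}}\to\mathbb{N}$ a finite sequence $\Theta(G)=\langle f_0,\dots,f_k\rangle$ of elements of $\mathbb{N}^{\mathbb{N}}$. $\textsf{SFF}(\Theta)$ ("$\Theta$ is a special fan functional") is the statement: for all $G:\mathbb{N}^{\mathbb{N}}\to\mathbb{N}$ and all $f\in2^{\mathbb{N}}$ there is an entry $g$ of $\Theta(G)$ with $f\in[\overline{g}G(g)]$. That such a $\Theta$ is computable means that the (suitably coded) map giving the length of $\Theta(G)$ and the values $\Theta(G)(i)(n)$ is computable. $\exists^3$ is the functional of type 3 which, for every $Y:\mathbb{N}^{\mathbb{N}}\to\mathbb{N}$, satisfies $\exists^3(Y)=0$ if and only if $(\exists f\in\mathbb{N}^{\mathbb{N}})(Y(f)=0)$ (and $\exists^3(Y)=1$ otherwise). -}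

module Defs where

open import Data.Nat using (ℕ; zero; suc; _+_; _*_; _^_; _<_)
open import Data.Fin using (Fin; toℕ)
open import Data.List using (List; []; _∷_; _++_; length; lookup; applyUpTo)
open import Data.List.Relation.Unary.All using (All; []; _∷_)
open import Data.List.Relation.Unary.All.Properties using (++⁺)
open import Data.List.Relation.Unary.Any using (Any)
open import Data.Product using (Σ-syntax; ∃-syntax; _×_)
open import Function using (_⇔_)
open import Relation.Nullary using (¬_)
open import Relation.Binary.PropositionalEquality using (_≡_)

-- The pure types over ℕ.  Under excluded middle and function extensionality
-- these are the levels of the full set-theoretic type structure.
Tp : ℕ → Set
Tp zero    = ℕ
Tp (suc j) = Tp j → ℕ

Args : List ℕ → Set
Args = All Tp

-- One constructor for each of Kleene's schemes, carrying the numerical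
-- parameters and the subindices of the scheme.  The types of the arguments are
-- not recorded in the index; they are part of the computation relation below.
data Index : Set where
  S1 : Index
  S2 : (q : ℕ) → Index
  S3 : Index
  S4 : (d c : Index) → Index
  S5 : (d c : Index) → Index
  S6 : (k : ℕ) (d : Index) → Index
  S7 : Index
  S8 : (d : Index) → Index
  S9 : (m : ℕ) → Index

-- A bijective coding of finite sequences, by uniqueness of the decomposition
-- of a positive number as a power of two times an odd number.
⟨_⟩ : List ℕ → ℕ
⟨ [] ⟩     = 0
⟨ n ∷ ns ⟩ = 2 ^ n * (1 + 2 * ⟨ ns ⟩)

-- The (injective) numbering of indices that S9 refers to.
⌜_⌝ : Index → ℕ
⌜ S1 ⌝     = ⟨ 1 ∷ [] ⟩
⌜ S2 q ⌝   = ⟨ 2 ∷ q ∷ [] ⟩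
⌜ S3 ⌝     = ⟨ 3 ∷ [] ⟩
⌜ S4 d c ⌝ = ⟨ 4 ∷ ⌜ d ⌝ ∷ ⌜ c ⌝ ∷ [] ⟩
⌜ S5 d c ⌝ = ⟨ 5 ∷ ⌜ d ⌝ ∷ ⌜ c ⌝ ∷ [] ⟩
⌜ S6 k d ⌝ = ⟨ 6 ∷ k ∷ ⌜ d ⌝ ∷ [] ⟩
⌜ S7 ⌝     = ⟨ 7 ∷ [] ⟩
⌜ S8 d ⌝   = ⟨ 8 ∷ ⌜ d ⌝ ∷ [] ⟩
⌜ S9 m ⌝   = ⟨ 9 ∷ m ∷ [] ⟩

infix 4 ｛_｝_≃_

-- ｛ e ｝ xs ≃ y : the computation with index e on the arguments xs, which may
-- be of any pure types in any order, terminates with value y.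
--  * S6 moves the argument in position k to the front; iterating it yields all
--    permutations of the arguments.
--  * In S8 the subcomputation has to terminate for every σ, and g is the total
--    functional so obtained.
--  * S9 m runs the index coded by the first argument on the next m arguments.
data ｛_｝_≃_ : Index → ∀ {Γ} → Args Γ → ℕ → Set where
  s1 : ∀ {Γ} {b : Args Γ} {x : Tp 0} →
       ｛ S1 ｝ (x ∷ b) ≃ suc x
  s2 : ∀ {Γ} {b : Args Γ} {q} →
       ｛ S2 q ｝ b ≃ q
  s3 : ∀ {Γ} {b : Args Γ} {x : Tp 0} →
       ｛ S3 ｝ (x ∷ b) ≃ x
  s4 : ∀ {Γ} {b : Args Γ} {d c} {x : Tp 0} {y} →
       ｛ c ｝ b ≃ x →
       ｛ d ｝ (x ∷ b) ≃ y →
       ｛ S4 d c ｝ b ≃ y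
  s5-zero : ∀ {Γ} {b : Args Γ} {d c y} →
       ｛ d ｝ b ≃ y →
       ｛ S5 d c ｝ (zero ∷ b) ≃ y
  s5-suc : ∀ {Γ} {b : Args Γ} {d c} {x z : Tp 0} {y} →
       ｛ S5 d c ｝ (x ∷ b) ≃ z →
       ｛ c ｝ (x ∷ z ∷ b) ≃ y →
       ｛ S5 d c ｝ (suc x ∷ b) ≃ y
  s6 : ∀ {Γ Δ j} {a : Args Γ} {φ : Tp j} {b : Args Δ} {d y} →
       ｛ d ｝ (φ ∷ ++⁺ a b) ≃ y →
       ｛ S6 (length Γ) d ｝ (++⁺ a (φ ∷ b)) ≃ y
  s7 : ∀ {Γ} {b : Args Γ} {α : Tp 1} {x : Tp 0} →
       ｛ S7 ｝ (α ∷ x ∷ b) ≃ α x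
  s8 : ∀ {Γ j} {b : Args Γ} {φ : Tp (2 + j)} {d} (g : Tp (1 + j)) →
       (∀ (σ : Tp j) → ｛ d ｝ (φ ∷ σ ∷ b) ≃ g σ) →
       ｛ S8 d ｝ (φ ∷ b) ≃ φ g
  s9 : ∀ {Γ Δ} {b : Args Γ} {c : Args Δ} {e y} →
       ｛ e ｝ b ≃ y →
       ｛ S9 (length Γ) ｝ (⌜ e ⌝ ∷ ++⁺ b c) ≃ y

infix 10 _↾_
infix 4 _∈[_]

_↾_ : (ℕ → ℕ) → ℕ → List ℕ
f ↾ N = applyUpTo f N

_∈[_] : (ℕ → ℕ) → List ℕ → Set
f ∈[ σ ] = f ↾ length σ ≡ σ

Binary : (ℕ → ℕ) → Set
Binary f = ∀ n → f n < 2

SFF : (Tp 2 → List (Tp 1)) → Set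
SFF Θ = ∀ (G : Tp 2) (f : Tp 1) → Binary f → Any (λ g → f ∈[ g ↾ G g ]) (Θ G)

IsExists³ : Tp 3 → Set
IsExists³ E = (∀ (Y : Tp 2) → E Y ≡ 0 ⇔ (∃[ f ] Y f ≡ 0))
            × (∀ (Y : Tp 2) → ¬ (∃[ f ] Y f ≡ 0) → E Y ≡ 1)

-- Both indices are uniform in G; the values are required only for positions i
-- inside the sequence Θ G.
ComputableFrom : Tp 3 → (Tp 2 → List (Tp 1)) → Set
ComputableFrom E Θ =
    (Σ[ e ∈ Index ] ∀ (G : Tp 2) →
       ｛ e ｝ (E ∷ G ∷ []) ≃ length (Θ G))
  × (Σ[ e ∈ Index ] ∀ (G : Tp 2) (i : Fin (length (Θ G))) (n : ℕ) →
       ｛ e ｝ (E ∷ G ∷ toℕ i ∷ n ∷ []) ≃ lookup (Θ G) i n)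

{-# OPTIONS --safe #-}
module Submission where

-- Put the binary functions in lexicographic order and list, by transfinite
-- recursion, the least one not yet covered by a neighbourhood [ g ↾ G g ] of an
-- earlier entry g.  The entries are well-ordered, cover Cantor space, and are
-- determined by their prefixes g ↾ G g, so initial segments of the list are coded
-- by functions and being an entry is decidable from ∃³.  Well-ordering replaces
-- choice: the least entry with a decidable property is computed digit by digit.
-- No unbounded search is needed either: by compactness some entry x is such that
-- the entries g with G g ≤ G x already cover Cantor space; N = G x for the least
-- such x is a value of G, and Θ G consists, for each binary prefix of length N,
-- of the least entry g with G g ≤ N covering it.

open import Defs
open import Axiom.ExcludedMiddle using (ExcludedMiddle)
open import Axiom.Extensionality.Propositional using (Extensionality)
open import Data.Empty using (⊥-elim)
open import Data.Fin using (Fin; toℕ)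
open import Data.List using (List; []; _∷_; _++_; length; lookup; applyUpTo)
open import Data.List.Membership.Propositional using (_∈_)
open import Data.List.Properties using (length-applyUpTo; lookup-applyUpTo)
open import Data.List.Relation.Unary.All as All using ([]; _∷_)
open import Data.List.Relation.Unary.All.Properties using (++⁺)
open import Data.List.Relation.Unary.Any using (Any; here; there)
open import Data.List.Relation.Unary.Any.Properties using (applyUpTo⁺)
open import Data.Nat using (ℕ; zero; suc; _+_; _∸_; _⊔_; _≤_; _<_; z≤n; s≤s)
open import Data.Nat.Induction using (<-rec)
open import Data.Nat.Properties
open import Data.Product using (Σ; Σ-syntax; ∃; ∃-syntax; _×_; _,_; proj₁; proj₂)
open import Data.Sum using (_⊎_; inj₁; inj₂)
open import Function using (_⇔_; mk⇔; Equivalence; _∘_)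
open import Function.Construct.Composition using (_⇔-∘_)
open import Level using (0ℓ)
open import Relation.Binary.Definitions using (tri<; tri≈; tri>)
open import Relation.Binary.PropositionalEquality
  using (_≡_; _≢_; refl; sym; trans; cong; cong₂; subst)
open import Relation.Nullary using (¬_; Dec; yes; no)
open import Relation.Nullary.Decidable using (decidable-stable)

open Equivalence using (to; from)

-- Kleene computability without S9

natrec : ℕ → (ℕ → ℕ → ℕ) → ℕ → ℕ
natrec z s zero    = z
natrec z s (suc n) = s n (natrec z s n)

-- Terms denote total functions, so the computation simulating a term always terminates, also below
-- S8. `apply` stands for G, `some₁` and `some₀` for ∃³.
data Term (Δ : List ℕ) : Set where
  var   : 0 ∈ Δ → Term Δ
  lit   : ℕ → Term Δ
  suc   : Term Δ → Term Δ
  rec   : Term Δ → Term (0 ∷ 0 ∷ Δ) → Term Δ → Term Δ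
  _·_   : 1 ∈ Δ → Term Δ → Term Δ
  apply : Term (0 ∷ Δ) → Term Δ
  some₁ : Term (1 ∷ Δ) → Term Δ
  some₀ : Term (0 ∷ Δ) → Term Δ

pattern v0 = here refl
pattern v1 = there v0
pattern v2 = there v1

-- A number bound by some₀ is realized as the value at 0 of the function bound
-- by ∃³, since an argument list cannot be shortened.
data Ref (Γ : List ℕ) : ℕ → Set where
  arg : ∀ {j} → j ∈ Γ → Ref Γ j
  at0 : 1 ∈ Γ → Ref Γ 0

deref : ∀ {Γ j} → Args Γ → Ref Γ j → Tp j
deref ρ (arg x) = All.lookup ρ x
deref ρ (at0 x) = All.lookup ρ x 0

weaken : ∀ {Γ i j} → Ref Γ j → Ref (i ∷ Γ) j
weaken (arg x) = arg (there x)
weaken (at0 x) = at0 (there x)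

deref-weaken : ∀ {Γ i j} (φ : Tp i) (ρ : Args Γ) (R : Ref Γ j) →
               deref (φ ∷ ρ) (weaken R) ≡ deref ρ R
deref-weaken φ ρ (arg x) = refl
deref-weaken φ ρ (at0 x) = refl

Realization : List ℕ → List ℕ → Set
Realization Δ Γ = ∀ {j} → j ∈ Δ → Ref Γ j

extend : ∀ {Δ Γ i j} → Ref (j ∷ Γ) i → Realization Δ Γ → Realization (i ∷ Δ) (j ∷ Γ)
extend R r (here refl) = R
extend R r (there x)   = weaken (r x)

lift : ∀ {Δ Γ i} → Realization Δ Γ → Realization (i ∷ Δ) (i ∷ Γ)
lift = extend (arg v0)

position : ∀ {Γ : List ℕ} {j} → j ∈ Γ → ℕ
position (here _)  = 0
position (there x) = suc (position x)

-- All argument lists start with ∃³ and G.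
compile : ∀ {Δ Γ} → Term Δ → Realization Δ Γ → Index
compile (var x) r with r x
... | arg y = S6 (2 + position y) S3
... | at0 y = S4 (S6 (3 + position y) S7) (S2 0)
compile (lit n) r     = S2 n
compile (suc t) r     = S4 S1 (compile t r)
compile (rec z s t) r =
  S4 (S5 (compile z r) (S6 3 (S6 3 (compile s (lift (lift r)))))) (compile t r)
compile (f · t) r with r f
... | arg y = S4 (S6 (3 + position y) S7) (compile t r)
compile (apply t) r   = S6 1 (S8 (S6 2 (compile t (lift r))))
compile (some₁ t) r   = S8 (S6 2 (S6 1 (compile t (lift r))))
compile (some₀ t) r   = S8 (S6 2 (S6 1 (compile t (extend (at0 v0) r))))

-- `s6` wants the argument list in the form `++⁺ before (φ ∷ after)`. The equation is one between
-- pairs, so that context and arguments are matched together.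
record Split {j Γ} (φ : Tp j) (k : ℕ) (ρ : Args Γ) : Set where
  constructor split
  field
    {Γ₁ Γ₂} : List ℕ
    before  : Args Γ₁
    after   : Args Γ₂
    len     : length Γ₁ ≡ k
    eq      : _≡_ {A = Σ (List ℕ) Args} (Γ , ρ)
                  (Γ₁ ++ j ∷ Γ₂ , ++⁺ before (φ ∷ after))

split-at : ∀ {j Γ} (x : j ∈ Γ) (ρ : Args Γ) → Split (All.lookup ρ x) (position x) ρ
split-at (here refl) (φ ∷ ρ) = split [] ρ refl refl
split-at (there x)   (ψ ∷ ρ) with split-at x ρ
... | split a b len eq =
  split (ψ ∷ a) b (cong suc len) (cong (λ (Γ , ρ) → (_ ∷ Γ , ψ ∷ ρ)) eq)

s3-at : ∀ {Γ n k} {ρ : Args Γ} → Split {0} n k ρ → ｛ S6 k S3 ｝ ρ ≃ n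
s3-at (split a b refl refl) = s6 {a = a} s3

s7-at : ∀ {Γ α k n} {ρ : Args Γ} → Split {1} α k ρ → ｛ S6 (suc k) S7 ｝ (_∷_ {P = Tp} {x = 0} n ρ) ≃ α n
s7-at {n = n} (split a b refl refl) = s6 {a = n ∷ a} s7

-- Evaluation of terms and correctness of their compilation.

module Evaluation (∃³ : Tp 3) (G : Tp 2) where

  eval : ∀ {Δ} → Term Δ → Args Δ → ℕ
  eval (var x) ρ     = All.lookup ρ x
  eval (lit n) ρ     = n
  eval (suc t) ρ     = suc (eval t ρ)
  eval (rec z s t) ρ = natrec (eval z ρ) (λ p v → eval s (p ∷ v ∷ ρ)) (eval t ρ)
  eval (f · t) ρ     = All.lookup ρ f (eval t ρ)
  eval (apply t) ρ   = G (λ n → eval t (n ∷ ρ))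
  eval (some₁ t) ρ   = ∃³ (λ f → eval t (f ∷ ρ))
  eval (some₀ t) ρ   = ∃³ (λ f → eval t (f 0 ∷ ρ))

  Realizes : ∀ {Δ Γ} → Realization Δ Γ → Args Γ → Args Δ → Set
  Realizes r σ ρ = ∀ {j} (x : j ∈ _) → deref σ (r x) ≡ All.lookup ρ x

  extend-realizes : ∀ {Δ Γ i j} {R : Ref (j ∷ Γ) i} {r : Realization Δ Γ} {σ ρ} {φ : Tp j} →
                    Realizes r σ ρ →
                    Realizes (extend R r) (φ ∷ σ) (deref (φ ∷ σ) R ∷ ρ)
  extend-realizes h (here refl) = refl
  extend-realizes {r = r} {σ} {φ = φ} h (there x) = trans (deref-weaken φ σ (r x)) (h x)

  compile-correct : ∀ {Δ Γ} (t : Term Δ) (r : Realization Δ Γ) {σ ρ} → Realizes r σ ρ →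
                    ｛ compile t r ｝ (∃³ ∷ G ∷ σ) ≃ eval t ρ
  compile-correct (var x) r {σ} h with r x | h x
  ... | arg y | eq = subst (λ n → ｛ _ ｝ _ ≃ n) eq (s3-at (split-at (there (there y)) _))
  ... | at0 y | eq = subst (λ n → ｛ _ ｝ _ ≃ n) eq (s4 s2 (s7-at (split-at (there (there y)) _)))
  compile-correct (lit n) r h = s2
  compile-correct (suc t) r h = s4 (compile-correct t r h) s1
  compile-correct (rec z s t) r {σ} {ρ} h = s4 (compile-correct t r h) (loop (eval t ρ))
    where
    loop : ∀ n → ｛ S5 (compile z r) (S6 3 (S6 3 (compile s (lift (lift r))))) ｝
                   (_∷_ {P = Tp} {x = 0} n (∃³ ∷ G ∷ σ))
                 ≃ natrec (eval z ρ) (λ p v → eval s (p ∷ v ∷ ρ)) n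
    loop zero    = s5-zero (compile-correct z r h)
    -- S5 places the predecessor and the previous value before ∃³ and G; moving G and then ∃³ to the
    -- front restores the order.
    loop (suc n) = s5-suc (loop n)
      (s6 {a = n ∷ v ∷ ∃³ ∷ []} (s6 {a = G ∷ n ∷ v ∷ []}
        (compile-correct s (lift (lift r))
          (extend-realizes {r = lift r} (extend-realizes {r = r} h)))))
      where
      v : Tp 0
      v = natrec (eval z ρ) (λ p v → eval s (p ∷ v ∷ ρ)) n
  compile-correct (f · t) r h with r f | h f
  ... | arg y | eq = subst (λ α → ｛ _ ｝ _ ≃ α (eval t _)) eq
    (s4 (compile-correct t r h) (s7-at (split-at (there (there y)) _)))
  compile-correct (apply t) r h =
    s6 {a = ∃³ ∷ []} (s8 _ λ n → s6 {a = G ∷ n ∷ []}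
      (compile-correct t (lift r) (extend-realizes {r = r} h)))
  compile-correct (some₁ t) r h =
    s8 _ λ f → s6 {a = ∃³ ∷ f ∷ []} (s6 {a = G ∷ []}
      (compile-correct t (lift r) (extend-realizes {r = r} h)))
  compile-correct (some₀ t) r h =
    s8 _ λ f → s6 {a = ∃³ ∷ f ∷ []} (s6 {a = G ∷ []}
      (compile-correct t (extend (at0 v0) r) (extend-realizes {r = r} h)))

-- A formula language over the terms

-- Defined through `natrec`, so that the corresponding terms evaluate to these functions
-- definitionally.
add monus pair : ℕ → ℕ → ℕ
add m n   = natrec m (λ _ v → suc v) n
monus m n = natrec m (λ _ v → natrec 0 (λ p _ → p) v) n

negate double pow2 : ℕ → ℕ
negate n = natrec 1 (λ _ _ → 0) n
double n = natrec 0 (λ _ v → suc (suc v)) n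
pow2 n   = natrec 1 (λ _ v → double v) n

-- The number 2^m (2n + 1); parity makes the coding injective.
pair m n = natrec (suc (double n)) (λ _ v → double v) m

-- The leading digit 1 makes the code determine the length of the prefix.
prefixCode : (ℕ → ℕ) → ℕ → ℕ
prefixCode f n = natrec 1 (λ k v → add (double v) (f k)) n

addᵗ monusᵗ pairᵗ : ∀ {Δ} → Term Δ → Term Δ → Term Δ
addᵗ t u   = rec t (suc (var v1)) u
monusᵗ t u = rec t (rec (lit 0) (var v0) (var v1)) u

negateᵗ doubleᵗ pow2ᵗ : ∀ {Δ} → Term Δ → Term Δ
negateᵗ t = rec (lit 1) (lit 0) t
doubleᵗ t = rec (lit 0) (suc (suc (var v1))) t
pow2ᵗ t   = rec (lit 1) (doubleᵗ (var v1)) t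

pairᵗ t u = rec (suc (doubleᵗ u)) (doubleᵗ (var v1)) t

prefixCodeᵗ : ∀ {Δ} → 1 ∈ Δ → Term Δ → Term Δ
prefixCodeᵗ f t =
  rec (lit 1) (addᵗ (doubleᵗ (var v1)) (there (there f) · var v0)) t

add≡+ : ∀ m n → add m n ≡ m + n
add≡+ m zero    = sym (+-identityʳ m)
add≡+ m (suc n) = trans (cong suc (add≡+ m n)) (sym (+-suc m n))

monus≡∸ : ∀ m n → monus m n ≡ m ∸ n
monus≡∸ m zero    = refl
monus≡∸ m (suc n) = trans (pred≡ (monus m n))
  (trans (cong (_∸ 1) (monus≡∸ m n)) (trans (∸-+-assoc m n 1) (cong (m ∸_) (+-comm n 1))))
  where
  pred≡ : ∀ k → natrec 0 (λ p _ → p) k ≡ k ∸ 1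
  pred≡ zero    = refl
  pred≡ (suc k) = refl

double≡+ : ∀ n → double n ≡ n + n
double≡+ zero    = refl
double≡+ (suc n) = cong suc (trans (cong suc (double≡+ n)) (sym (+-suc n n)))

double-injective : ∀ {m n} → double m ≡ double n → m ≡ n
double-injective {zero}  {zero}  eq = refl
double-injective {suc m} {suc n} eq = cong suc (double-injective (suc-injective (suc-injective eq)))

double≢suc-double : ∀ m n → double m ≢ suc (double n)
double≢suc-double (suc m) (suc n) eq = double≢suc-double m n (suc-injective (suc-injective eq))

pair-injective : ∀ {m n m′ n′} → pair m n ≡ pair m′ n′ → m ≡ m′ × n ≡ n′
pair-injective {zero}  {n} {zero}   {n′} eq = refl , double-injective (suc-injective eq)
pair-injective {zero}  {n} {suc m′} {n′} eq = ⊥-elim (double≢suc-double (pair m′ n′) n (sym eq))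
pair-injective {suc m} {n} {zero}   {n′} eq = ⊥-elim (double≢suc-double (pair m n) n′ eq)
pair-injective {suc m} {n} {suc m′} {n′} eq =
  let m≡ , n≡ = pair-injective {m} {n} {m′} {n′} (double-injective eq) in cong suc m≡ , n≡

infix 4 _agrees_below_

_agrees_below_ : (ℕ → ℕ) → (ℕ → ℕ) → ℕ → Set
f agrees g below n = ∀ k → k < n → f k ≡ g k

below-suc : ∀ {f g n} → f agrees g below n → f n ≡ g n → f agrees g below suc n
below-suc {n = n} h e k k<1+n with m<1+n⇒m<n∨m≡n k<1+n
... | inj₁ k<n  = h k k<n
... | inj₂ refl = e

append-digit-injective : ∀ {m n b c} → b < 2 → c < 2 →
  add (double m) b ≡ add (double n) c → m ≡ n × b ≡ c
append-digit-injective {b = 0} {0} _ _ eq = double-injective eq , refl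
append-digit-injective {m} {n} {0} {1} _ _ eq = ⊥-elim (double≢suc-double m n eq)
append-digit-injective {m} {n} {1} {0} _ _ eq = ⊥-elim (double≢suc-double n m (sym eq))
append-digit-injective {b = 1} {1} _ _ eq = double-injective (suc-injective eq) , refl
append-digit-injective {b = suc (suc _)} (s≤s (s≤s ())) _ _
append-digit-injective {b = 0} {suc (suc _)} _ (s≤s (s≤s ())) _
append-digit-injective {b = 1} {suc (suc _)} _ (s≤s (s≤s ())) _

0<prefixCode : ∀ f n → 0 < prefixCode f n
0<prefixCode f zero    = s≤s z≤n
0<prefixCode f (suc n) = begin-strict
  0                                        <⟨ 0<prefixCode f n ⟩
  prefixCode f n                           ≤⟨ m≤m+n _ _ ⟩
  prefixCode f n + prefixCode f n          ≡⟨ double≡+ (prefixCode f n) ⟨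
  double (prefixCode f n)                  ≤⟨ m≤m+n _ (f n) ⟩
  double (prefixCode f n) + f n            ≡⟨ add≡+ _ (f n) ⟨
  add (double (prefixCode f n)) (f n)      ∎
  where open ≤-Reasoning

1<prefixCode-suc : ∀ f n → 1 < prefixCode f (suc n)
1<prefixCode-suc f n = begin
  2                                        ≤⟨ +-mono-≤ (0<prefixCode f n) (0<prefixCode f n) ⟩
  prefixCode f n + prefixCode f n          ≡⟨ double≡+ (prefixCode f n) ⟨
  double (prefixCode f n)                  ≤⟨ m≤m+n _ (f n) ⟩
  double (prefixCode f n) + f n            ≡⟨ add≡+ _ (f n) ⟨
  add (double (prefixCode f n)) (f n)      ∎
  where open ≤-Reasoning

prefixCode-injective : ∀ {f g} → Binary f → Binary g → ∀ m n →
  prefixCode f m ≡ prefixCode g n → m ≡ n × f agrees g below m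
prefixCode-injective bf bg zero zero eq = refl , λ _ ()
prefixCode-injective {g = g} bf bg zero (suc n) eq = ⊥-elim (<⇒≢ (1<prefixCode-suc g n) eq)
prefixCode-injective {f} bf bg (suc m) zero eq = ⊥-elim (<⇒≢ (1<prefixCode-suc f m) (sym eq))
prefixCode-injective {f} {g} bf bg (suc m) (suc n) eq
  with append-digit-injective (bf m) (bg n) eq
... | eq′ , digit with prefixCode-injective bf bg m n eq′
... | refl , agree = refl , below-suc agree digit

prefixCode<pow2 : ∀ {f} → Binary f → ∀ n → prefixCode f n < pow2 (suc n)
prefixCode<pow2 bf zero        = s≤s (s≤s z≤n)
prefixCode<pow2 {f} bf (suc n) = begin-strict
  add (double c) (f n)      ≡⟨ add≡+ (double c) (f n) ⟩
  double c + f n            <⟨ +-monoʳ-< (double c) (bf n) ⟩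
  double c + 2              ≡⟨ +-comm (double c) 2 ⟩
  double (suc c)            ≡⟨ double≡+ (suc c) ⟩
  suc c + suc c             ≤⟨ +-mono-≤ (prefixCode<pow2 bf n) (prefixCode<pow2 bf n) ⟩
  pow2 (suc n) + pow2 (suc n) ≡⟨ double≡+ (pow2 (suc n)) ⟨
  pow2 (suc (suc n))        ∎
  where
  open ≤-Reasoning
  c : ℕ
  c = prefixCode f n

infix  8 _≈_ _≼_ _≺_
infix  7 ∼_
infixr 6 _∧_
infixr 5 _⇒_

data Formula (Δ : List ℕ) : Set where
  _≈_ _≼_ : Term Δ → Term Δ → Formula Δ
  ∼_      : Formula Δ → Formula Δ
  _∧_ _⇒_ : Formula Δ → Formula Δ → Formula Δ
  ∃₁ ∀₁   : Formula (1 ∷ Δ) → Formula Δ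
  ∃₀ ∀₀   : Formula (0 ∷ Δ) → Formula Δ

_≺_ : ∀ {Δ} → Term Δ → Term Δ → Formula Δ
t ≺ u = suc t ≼ u

-- The value 0 stands for truth.
truth : ∀ {Δ} → Formula Δ → Term Δ
truth (t ≈ u) = addᵗ (monusᵗ t u) (monusᵗ u t)
truth (t ≼ u) = monusᵗ t u
truth (∼ φ)   = negateᵗ (truth φ)
truth (φ ∧ ψ) = addᵗ (truth φ) (truth ψ)
truth (φ ⇒ ψ) = negateᵗ (addᵗ (truth φ) (negateᵗ (truth ψ)))
truth (∃₁ φ)  = some₁ (truth φ)
truth (∀₁ φ)  = negateᵗ (some₁ (negateᵗ (truth φ)))
truth (∃₀ φ)  = some₀ (truth φ)
truth (∀₀ φ)  = negateᵗ (some₀ (negateᵗ (truth φ)))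

add≡0 : ∀ {m n} {P Q : Set} → m ≡ 0 ⇔ P → n ≡ 0 ⇔ Q → add m n ≡ 0 ⇔ (P × Q)
add≡0 {m} {n} p q = mk⇔
  (λ eq → let eq′ = trans (sym (add≡+ m n)) eq in
          to p (m+n≡0⇒m≡0 m eq′) , to q (m+n≡0⇒n≡0 m eq′))
  (λ (x , y) → trans (add≡+ m n) (trans (cong (_+ n) (from p x)) (from q y)))

negate≡0 : ∀ {n} {P : Set} → n ≡ 0 ⇔ P → negate n ≡ 0 ⇔ (¬ P)
negate≡0 {zero}  p = mk⇔ (λ ()) (λ ¬P → ⊥-elim (¬P (to p refl)))
negate≡0 {suc n} p = mk⇔ (λ _ x → 1+n≢0 (from p x)) (λ _ → refl)

-- Comparing the truth value with 0 decides the statement. This validates implication and the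
-- universal quantifiers, which `truth` expresses through negation.
stable : ∀ {n} {P : Set} → n ≡ 0 ⇔ P → ¬ ¬ P → P
stable {n} p ¬¬P = to p (decidable-stable (n ≟ 0) (λ n≢0 → ¬¬P (n≢0 ∘ from p)))

monus≡0 : ∀ m n → monus m n ≡ 0 ⇔ m ≤ n
monus≡0 m n = mk⇔ (λ eq → m∸n≡0⇒m≤n (trans (sym (monus≡∸ m n)) eq))
                  (λ m≤n → trans (monus≡∸ m n) (m≤n⇒m∸n≡0 m≤n))

-- Deciding formulas by ∃³.

module Satisfaction (∃³ : Tp 3) (is∃³ : IsExists³ ∃³) (G : Tp 2) where
  open Evaluation ∃³ G

  ⟦_⟧ : ∀ {Δ} → Formula Δ → Args Δ → Set
  ⟦ t ≈ u ⟧ ρ = eval t ρ ≡ eval u ρ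
  ⟦ t ≼ u ⟧ ρ = eval t ρ ≤ eval u ρ
  ⟦ ∼ φ ⟧ ρ   = ¬ ⟦ φ ⟧ ρ
  ⟦ φ ∧ ψ ⟧ ρ = ⟦ φ ⟧ ρ × ⟦ ψ ⟧ ρ
  ⟦ φ ⇒ ψ ⟧ ρ = ⟦ φ ⟧ ρ → ⟦ ψ ⟧ ρ
  ⟦ ∃₁ φ ⟧ ρ  = ∃[ f ] ⟦ φ ⟧ (f ∷ ρ)
  ⟦ ∀₁ φ ⟧ ρ  = ∀ f → ⟦ φ ⟧ (f ∷ ρ)
  ⟦ ∃₀ φ ⟧ ρ  = ∃[ n ] ⟦ φ ⟧ (n ∷ ρ)
  ⟦ ∀₀ φ ⟧ ρ  = ∀ n → ⟦ φ ⟧ (n ∷ ρ)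

  ∃³≡0 : ∀ {P : Tp 1 → Set} (Y : Tp 2) → (∀ f → Y f ≡ 0 ⇔ P f) → ∃³ Y ≡ 0 ⇔ ∃ P
  ∃³≡0 Y h = mk⇔ (λ eq → let f , e = to (proj₁ is∃³ Y) eq in f , to (h f) e)
                 (λ (f , x) → from (proj₁ is∃³ Y) (f , from (h f) x))

  truth≡0 : ∀ {Δ} (φ : Formula Δ) (ρ : Args Δ) → eval (truth φ) ρ ≡ 0 ⇔ ⟦ φ ⟧ ρ
  truth≡0 (t ≈ u) ρ =
    let p = add≡0 (monus≡0 (eval t ρ) (eval u ρ)) (monus≡0 (eval u ρ) (eval t ρ)) in
    mk⇔ (λ eq → let x , y = to p eq in ≤-antisym x y)
        (λ eq → from p (≤-reflexive eq , ≤-reflexive (sym eq)))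
  truth≡0 (t ≼ u) ρ = monus≡0 (eval t ρ) (eval u ρ)
  truth≡0 (∼ φ) ρ   = negate≡0 (truth≡0 φ ρ)
  truth≡0 (φ ∧ ψ) ρ = add≡0 (truth≡0 φ ρ) (truth≡0 ψ ρ)
  truth≡0 (φ ⇒ ψ) ρ =
    let p = negate≡0 (add≡0 (truth≡0 φ ρ) (negate≡0 (truth≡0 ψ ρ))) in
    mk⇔ (λ eq x → stable (truth≡0 ψ ρ) (λ ¬y → to p eq (x , ¬y)))
        (λ f → from p (λ (x , ¬y) → ¬y (f x)))
  truth≡0 (∃₁ φ) ρ  = ∃³≡0 _ (λ f → truth≡0 φ (f ∷ ρ))
  truth≡0 (∀₁ φ) ρ  =
    let p = negate≡0 (∃³≡0 _ (λ f → negate≡0 (truth≡0 φ (f ∷ ρ)))) in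
    mk⇔ (λ eq f → stable (truth≡0 φ (f ∷ ρ)) (λ ¬x → to p eq (f , ¬x)))
        (λ h → from p (λ (f , ¬x) → ¬x (h f)))
  truth≡0 (∃₀ φ) ρ  =
    let p = ∃³≡0 _ (λ f → truth≡0 φ (f 0 ∷ ρ)) in
    mk⇔ (λ eq → let f , x = to p eq in f 0 , x) (λ (n , x) → from p ((λ _ → n) , x))
  truth≡0 (∀₀ φ) ρ  =
    let p = negate≡0 (∃³≡0 _ (λ f → negate≡0 (truth≡0 φ (f 0 ∷ ρ)))) in
    mk⇔ (λ eq n → stable (truth≡0 φ (n ∷ ρ)) (λ ¬x → to p eq ((λ _ → n) , ¬x)))
        (λ h → from p (λ (f , ¬x) → ¬x (h (f 0))))

-- The lexicographic order on functions

infix 4 _⊏_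

_⊏_ : (ℕ → ℕ) → (ℕ → ℕ) → Set
f ⊏ g = ∃[ n ] f agrees g below n × f n < g n

⊏-irrefl : ∀ {f} → ¬ (f ⊏ f)
⊏-irrefl (n , _ , f<f) = n≮n _ f<f

⊏-trans : ∀ {f g h} → f ⊏ g → g ⊏ h → f ⊏ h
⊏-trans {f} {g} {h} (m , f≈g , f<g) (n , g≈h , g<h) with <-cmp m n
... | tri< m<n _ _  = m , (λ k k<m → trans (f≈g k k<m) (g≈h k (<-trans k<m m<n)))
                        , subst (f m <_) (g≈h m m<n) f<g
... | tri≈ _ refl _ = m , (λ k k<m → trans (f≈g k k<m) (g≈h k k<m)) , <-trans f<g g<h
... | tri> _ _ n<m  = n , (λ k k<n → trans (f≈g k (<-trans k<n n<m)) (g≈h k k<n))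
                        , subst (_< h n) (sym (f≈g n n<m)) g<h

-- A sequence x built one digit at a time, keeping an invariant Φ of the set of
-- elements of P that agree with x so far.
module Refinement
  (Φ : (Tp 1 → Set) → Set) (Digit : (Tp 1 → Set) → ℕ → ℕ → Set)
  (refine : ∀ Q n → Φ Q → ∃[ d ] Digit Q n d × Φ (λ f → Q f × f n ≡ d))
  (P : Tp 1 → Set) (start : Φ P) where

  stage : ℕ → Σ[ Q ∈ (Tp 1 → Set) ] Φ Q
  stage zero    = P , start
  stage (suc n) = let Q , q = stage n ; d , _ , q′ = refine Q n q in
                  (λ f → Q f × f n ≡ d) , q′

  limit : ℕ → ℕ
  limit n = proj₁ (refine _ n (proj₂ (stage n)))

  limit-digit : ∀ n → Digit (proj₁ (stage n)) n (limit n)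
  limit-digit n = proj₁ (proj₂ (refine _ n (proj₂ (stage n))))

  stage⇔ : ∀ n f → proj₁ (stage n) f ⇔ (P f × f agrees limit below n)
  stage⇔ zero f    = mk⇔ (λ x → x , λ _ ()) proj₁
  stage⇔ (suc n) f = mk⇔
    (λ (q , e) → let p , a = to (stage⇔ n f) q in p , below-suc a e)
    (λ (p , a) → from (stage⇔ n f) (p , λ k k<n → a k (m<n⇒m<1+n k<n)) , a n (n<1+n n))

-- Comparison and infima under excluded middle.

module Classical (ext : Extensionality 0ℓ 0ℓ) (lem : ExcludedMiddle 0ℓ) where

  dne : {P : Set} → ¬ ¬ P → P
  dne = decidable-stable lem

  least : (S : ℕ → Set) → ∃ S → ∃[ d ] S d × (∀ m → S m → d ≤ m)
  least S (d , s) = <-rec (λ d → S d → ∃[ d ] S d × (∀ m → S m → d ≤ m)) step d s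
    where
    step : ∀ d → (∀ {m} → m < d → S m → ∃[ d ] S d × (∀ m → S m → d ≤ m)) →
           S d → ∃[ d ] S d × (∀ m → S m → d ≤ m)
    step d ih s with lem {∃[ m ] m < d × S m}
    ... | yes (m , m<d , s′) = ih m<d s′
    ... | no  none           = d , s , λ m s′ → ≮⇒≥ (λ m<d → none (m , m<d , s′))

  ⊏-cmp : ∀ f g → f ⊏ g ⊎ f ≡ g ⊎ g ⊏ f
  ⊏-cmp f g with lem {∃[ n ] f n ≢ g n}
  ... | no  same = inj₂ (inj₁ (ext λ n → decidable-stable (f n ≟ g n) (λ ne → same (n , ne))))
  ... | yes diff with least (λ n → f n ≢ g n) diff
  ... | n , ne , min with <-cmp (f n) (g n)
  ... | tri< f<g _ _ = inj₁ (n , (λ k k<n → dne (λ ne → <⇒≱ k<n (min k ne))) , f<g)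
  ... | tri≈ _ eq _  = ⊥-elim (ne eq)
  ... | tri> _ _ g<f =
    inj₂ (inj₂ (n , (λ k k<n → sym (dne (λ ne → <⇒≱ k<n (min k ne)))) , g<f))

  ⊏-connex : ∀ {f g} → f ≢ g → ¬ (g ⊏ f) → f ⊏ g
  ⊏-connex {f} {g} f≢g g⊀f with ⊏-cmp f g
  ... | inj₁ f⊏g        = f⊏g
  ... | inj₂ (inj₁ eq)  = ⊥-elim (f≢g eq)
  ... | inj₂ (inj₂ g⊏f) = ⊥-elim (g⊀f g⊏f)

  -- Here `¬ (g ⊏ f)` serves as the non-strict order f ⊑ g.
  ⊑-⊏-trans : ∀ {f g h} → ¬ (g ⊏ f) → g ⊏ h → f ⊏ h
  ⊑-⊏-trans {f} {g} g⊀f g⊏h with ⊏-cmp f g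
  ... | inj₁ f⊏g         = ⊏-trans f⊏g g⊏h
  ... | inj₂ (inj₁ refl) = g⊏h
  ... | inj₂ (inj₂ g⊏f)  = ⊥-elim (g⊀f g⊏f)

  -- Each digit is the least one occurring among the elements of `P` that agree with the digits so
  -- far. The limit may lie outside `P`, hence the approximation clause.
  infimum : (P : Tp 1 → Set) → ∃ P →
            ∃[ x ] (∀ f → P f → ¬ (f ⊏ x)) × (∀ n → ∃[ f ] P f × f agrees x below n)
  infimum P inhabited = limit , lower , approximated
    where
    smallest : ∀ Q n → ∃ Q →
               ∃[ d ] (∀ f → Q f → d ≤ f n) × (∃[ f ] Q f × f n ≡ d)
    smallest Q n (f , q) with least (λ d → ∃[ f ] Q f × f n ≡ d) (f n , f , q , refl)
    ... | d , attained , min = d , (λ f q → min (f n) (f , q , refl)) , attained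
    open Refinement ∃ (λ Q n d → ∀ f → Q f → d ≤ f n) smallest P inhabited
    lower : ∀ f → P f → ¬ (f ⊏ limit)
    lower f p (n , agree , f<x) = <⇒≱ f<x (limit-digit n f (from (stage⇔ n f) (p , agree)))
    approximated : ∀ n → ∃[ f ] P f × f agrees limit below n
    approximated n = let f , q = proj₂ (stage n) in f , to (stage⇔ n f) q

  ⊏-⊑-trans : ∀ {f g h} → f ⊏ g → ¬ (h ⊏ g) → f ⊏ h
  ⊏-⊑-trans {f} {g} {h} f⊏g h⊀g with ⊏-cmp g h
  ... | inj₁ g⊏h         = ⊏-trans f⊏g g⊏h
  ... | inj₂ (inj₁ refl) = f⊏g
  ... | inj₂ (inj₂ h⊏g)  = ⊥-elim (h⊀g h⊏g)

  -- Chains of entries and their well-ordering.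

  module Chains (G : Tp 2) where

    -- Membership in the neighbourhood `[ g ↾ G g ]`, put pointwise so that a formula can express
    -- it.
    Covers : Tp 1 → Tp 1 → Set
    Covers g f = f agrees g below G g

    -- A chain is an initial segment of the transfinite sequence in which every
    -- entry is the least binary function not covered by the earlier entries.
    Chain : (Tp 1 → Set) → Set
    Chain A = ∀ f → A f → Binary f
                        × (∀ g → A g → g ⊏ f → ¬ Covers g f)
                        × (∀ h → Binary h → h ⊏ f → ∃[ g ] A g × ¬ (h ⊏ g) × Covers g h)

    Chain-resp : ∀ {A B} → (∀ f → A f ⇔ B f) → Chain A → Chain B
    Chain-resp e chain f b =
      let bin , uncovered , below = chain f (from (e f) b) in
      bin , (λ g b′ → uncovered g (from (e g) b′))
          , λ h bh h⊏f → let g , a , rest = below h bh h⊏f in g , to (e g) a , rest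

    infimum-binary : ∀ {P : Tp 1 → Set} {x} → (∀ f → P f → Binary f) →
                     (∀ n → ∃[ f ] P f × f agrees x below n) → Binary x
    infimum-binary bin approx n =
      let f , p , agree = approx (suc n) in subst (_< 2) (agree n (n<1+n n)) (bin f p n)

    covers-close : ∀ {f g h} → Covers g f → h agrees f below G g → Covers g h
    covers-close c agree k k<n = trans (agree k k<n) (c k k<n)

    -- An infimum that is not attained would be covered by some g ⊑ x, and g
    -- would cover later elements of the chain close to x.
    minimum : ∀ {A P} → Chain A → (∀ f → P f → A f) → ∃ P →
              ∃[ x ] P x × (∀ f → P f → ¬ (f ⊏ x))
    minimum {A} {P} chain P⊆A inhabited with infimum P inhabited
    ... | x , lower , approx = x , dne absurd , lower
      where
      absurd : ¬ ¬ P x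
      absurd ¬p =
        let above : ∀ f → P f → x ⊏ f
            above f p = ⊏-connex (λ { refl → ¬p p }) (lower f p)
            f₀ , p₀ = inhabited
            _ , _ , below = chain f₀ (P⊆A f₀ p₀)
            bx = infimum-binary (λ f p → proj₁ (chain f (P⊆A f p))) approx
            g , a , x⊀g , c = below x bx (above f₀ p₀)
            f , p , agree = approx (G g)
            _ , uncovered , _ = chain f (P⊆A f p)
        in uncovered g a (⊑-⊏-trans x⊀g (above f p)) (covers-close c agree)

    -- As x precedes the entry y of `A`, some entry w ⊑ x of `A` covers x. It differs from x, and it
    -- is not in `B`, where earlier entries do not cover x.
    chain-difference : ∀ {A B x y} → Chain A → Chain B → B x → ¬ A x → A y → ¬ (y ⊏ x) →
                       ∃[ w ] (A w × ¬ B w) × w ⊏ x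
    chain-difference {A} {B} {x} {y} chainA chainB bx ¬ax ay y⊀x
      with chainB x bx | chainA y ay
    ... | binary , uncovered , _ | _ , _ , below
      with below x binary (⊏-connex (λ eq → ¬ax (subst A (sym eq) ay)) y⊀x)
    ... | w , aw , x⊀w , c = w , (aw , λ bw → uncovered w bw w⊏x c) , w⊏x
      where
      w⊏x : w ⊏ x
      w⊏x = ⊏-connex (λ eq → ¬ax (subst A eq aw)) x⊀w

    -- Two applications of chain-difference lead from the least element of B ∖ A
    -- to a smaller one.
    chain-comparable : ∀ {A B f g} → Chain A → Chain B →
                       A f → B g → ¬ (f ⊏ g) → A g
    chain-comparable {A} {B} {f} {g} chainA chainB a b f⊀g = dne λ ¬a →
      absurd (minimum chainB (λ _ → proj₁) (g , b , ¬a , f , a , f⊀g))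
      where
      D : Tp 1 → Set
      -- The last conjunct keeps x at most an entry of `A`, as `chain-difference` requires.
      D x = B x × ¬ A x × (∃[ y ] A y × ¬ (y ⊏ x))
      absurd : ¬ (∃[ x ] D x × (∀ f → D f → ¬ (f ⊏ x)))
      absurd (x , (bx , ¬ax , y , ay , y⊀x) , min)
        with chain-difference chainA chainB bx ¬ax ay y⊀x
      ... | z , (az , ¬bz) , z⊏x
        with chain-difference chainB chainA az ¬bz bx (λ x⊏z → ⊏-irrefl (⊏-trans x⊏z z⊏x))
      ... | v , (bv , ¬av) , v⊏z =
        min v (bv , ¬av , y , ay , λ y⊏v → y⊀x (⊏-trans y⊏v v⊏x)) v⊏x
        where
        v⊏x : v ⊏ x
        v⊏x = ⊏-trans v⊏z z⊏x

    -- Of two distinct entries with the same prefix, the earlier would cover the later.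
    chain-injective : ∀ {A f g} → Chain A → A f → A g →
                      prefixCode f (G f) ≡ prefixCode g (G g) → f ≡ g
    chain-injective {f = f} {g} chain a b eq
      with chain f a | chain g b | ⊏-cmp f g
    ... | _ | _ | inj₂ (inj₁ f≡g) = f≡g
    ... | binary-f , _ | binary-g , uncovered , _ | inj₁ f⊏g =
      let _ , agree = prefixCode-injective binary-f binary-g (G f) (G g) eq in
      ⊥-elim (uncovered f a f⊏g (λ k k<n → sym (agree k k<n)))
    ... | binary-f , uncovered , _ | binary-g , _ | inj₂ (inj₂ g⊏f) =
      let _ , agree = prefixCode-injective binary-g binary-f (G g) (G f) (sym eq) in
      ⊥-elim (uncovered g b g⊏f (λ k k<n → sym (agree k k<n)))

    -- The rows of `c` form a countable family given by one function, over which ∃³ can quantify.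
    Row : Tp 1 → Tp 1 → Set
    Row c f = ∃[ m ] ∀ n → f n ≡ c (pair m n)

    uncurried : (F : ℕ → Tp 1) → ∃[ c ] ∀ m n → F m n ≡ c (pair m n)
    uncurried F = (λ k → value k lem) , λ m n → value-pair m n lem
      where
      value : ∀ k → Dec (∃[ m ] ∃[ n ] pair m n ≡ k) → ℕ
      value k (yes (m , n , _)) = F m n
      value k (no _)            = 0
      value-pair : ∀ m n d → F m n ≡ value (pair m n) d
      value-pair m n (yes (m′ , n′ , eq)) with pair-injective {m′} {n′} {m} {n} eq
      ... | refl , refl = refl
      value-pair m n (no none) = ⊥-elim (none (m , n , refl))

    -- The entries of a chain are determined by their prefixes up to G, so a
    -- chain is countable.
    chain-enumerable : ∀ {A x} → Chain A → A x → ∃[ c ] ∀ f → Row c f ⇔ A f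
    chain-enumerable {A} {x} chain a = c , λ f → mk⇔ (row⇒A f) (A⇒row f)
      where
      entry : ∀ m → Σ[ f ∈ Tp 1 ] A f × ∀ g → A g → prefixCode g (G g) ≡ m → f ≡ g
      entry m with lem {∃[ f ] A f × prefixCode f (G f) ≡ m}
      ... | yes (f , af , eq) =
        f , af , λ g ag eq′ → chain-injective chain af ag (trans eq (sym eq′))
      -- A number that codes no entry gets the row x, which keeps all rows inside `A`.
      ... | no none = x , a , λ g ag eq → ⊥-elim (none (g , ag , eq))
      c : Tp 1
      c = proj₁ (uncurried (proj₁ ∘ entry))
      entry≡c : ∀ m n → proj₁ (entry m) n ≡ c (pair m n)
      entry≡c = proj₂ (uncurried (proj₁ ∘ entry))
      row⇒A : ∀ f → Row c f → A f
      row⇒A f (m , eq) =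
        subst A (ext λ n → trans (entry≡c m n) (sym (eq n))) (proj₁ (proj₂ (entry m)))
      A⇒row : ∀ f → A f → Row c f
      A⇒row f af = m , λ n →
        trans (cong (λ g → g n) (sym (proj₂ (proj₂ (entry m)) f af refl))) (entry≡c m n)
        where
        m : ℕ
        m = prefixCode f (G f)

    -- The union of all coded chains. Nonempty chains are countable and hence coded, so this is the
    -- whole transfinite sequence.
    InChain : Tp 1 → Set
    InChain f = ∃[ c ] Chain (Row c) × Row c f

    -- By comparability, an entry of another chain that precedes f already belongs to the chain of
    -- f, so f stays uncovered in the union.
    inChain-chain : Chain InChain
    inChain-chain f (c , chain , row) =
      let binary , uncovered , below = chain f row in
      binary
      , (λ g (c′ , chain′ , row′) g⊏f → uncovered g
          (chain-comparable chain chain′ row row′ (λ f⊏g → ⊏-irrefl (⊏-trans f⊏g g⊏f))) g⊏f)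
      , λ h bh h⊏f → let g , row′ , rest = below h bh h⊏f in g , (c , chain , row′) , rest

    -- The least binary function not covered would be the next entry.
    inChain-covers : ∀ f → Binary f → ∃[ g ] InChain g × ¬ (f ⊏ g) × Covers g f
    inChain-covers f₀ binary-f₀ = dne λ uncovered-f₀ → contradictory
      (infimum (λ f → Binary f × ¬ Covered f) (f₀ , binary-f₀ , uncovered-f₀))
      where
      Covered : Tp 1 → Set
      Covered f = ∃[ g ] InChain g × ¬ (f ⊏ g) × Covers g f
      contradictory : ¬ (∃[ x ] (∀ f → Binary f × ¬ Covered f → ¬ (f ⊏ x))
                              × (∀ n → ∃[ f ] (Binary f × ¬ Covered f) × f agrees x below n))
      contradictory (x , lower , approx) =
        uncovered-x (x , inChain-x , ⊏-irrefl , λ _ _ → refl)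
        where
        binary-x : Binary x
        binary-x = infimum-binary (λ _ → proj₁) approx
        uncovered-x : ¬ Covered x
        uncovered-x (g , w , x⊀g , c) =
          let f , (bf , ¬cov) , agree = approx (G g) in
          ¬cov (g , w , (λ f⊏g → lower f (bf , ¬cov) (⊏-⊑-trans f⊏g x⊀g)) , covers-close c agree)
        -- Only entries before x are kept, so that x precedes no other element of `A`.
        A : Tp 1 → Set
        A f = (InChain f × f ⊏ x) ⊎ f ≡ x
        below-x : ∀ h → Binary h → h ⊏ x → Covered h
        below-x h bh h⊏x = dne λ ¬cov → lower h (bh , ¬cov) h⊏x
        chainA : Chain A
        chainA f (inj₁ (w , f⊏x)) =
          let binary , uncovered , below = inChain-chain f w in
          binary
          , (λ { g (inj₁ (w′ , _)) g⊏f → uncovered g w′ g⊏f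
               ; g (inj₂ refl) x⊏f → ⊥-elim (⊏-irrefl (⊏-trans x⊏f f⊏x)) })
          , λ h bh h⊏f →
              let g , w′ , h⊀g , c = below h bh h⊏f in
              g , inj₁ (w′ , ⊑-⊏-trans h⊀g (⊏-trans h⊏f f⊏x)) , h⊀g , c
        chainA f (inj₂ refl) =
          binary-x
          , (λ { g (inj₁ (w , g⊏x)) _ c →
                   uncovered-x (g , w , (λ x⊏g → ⊏-irrefl (⊏-trans x⊏g g⊏x)) , c)
               ; g (inj₂ refl) x⊏x _ → ⊏-irrefl x⊏x })
          , λ h bh h⊏x →
              let g , w , h⊀g , c = below-x h bh h⊏x in
              g , inj₁ (w , ⊑-⊏-trans h⊀g h⊏x) , h⊀g , c
        inChain-x : InChain x
        inChain-x =
          -- The extended chain is again countable, hence coded; so x is an entry, and it covers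
          -- itself.
          let c , e = chain-enumerable chainA (inj₂ refl) in
          c , Chain-resp (λ f → mk⇔ (from (e f)) (to (e f))) chainA , from (e x) (inj₂ refl)

    -- Compactness and the choice of a bound.

    CoveredWithin : ℕ → Tp 1 → Set
    CoveredWithin N f = ∃[ g ] InChain g × G g ≤ N × Covers g f

    -- Compactness of Cantor space for the cover by the entries of the chain.
    compactness : ∃[ N ] ∀ f → Binary f → CoveredWithin N f
    compactness = dne λ unbounded → contradictory unbounded
      where
      Unbounded : (Tp 1 → Set) → Set
      Unbounded Q = ¬ (∃[ N ] ∀ f → Binary f → Q f → CoveredWithin N f)
      bisect : ∀ Q n → Unbounded Q → ∃[ d ] d < 2 × Unbounded (λ f → Q f × f n ≡ d)
      bisect Q n u with lem {Unbounded (λ f → Q f × f n ≡ 0)}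
      ... | yes u₀ = 0 , s≤s z≤n , u₀
      ... | no ¬u₀ = 1 , s≤s (s≤s z≤n) , λ (N₁ , h₁) →
        let N₀ , h₀ = dne ¬u₀ in
        u (N₀ ⊔ N₁ , λ f bf q → glue N₀ h₀ N₁ h₁ f bf q (f n) refl)
        where
        weakenBound : ∀ {M N f} → M ≤ N → CoveredWithin M f → CoveredWithin N f
        weakenBound M≤N (g , w , Gg≤M , c) = g , w , ≤-trans Gg≤M M≤N , c
        glue : ∀ N₀ → (∀ f → Binary f → Q f × f n ≡ 0 → CoveredWithin N₀ f) →
               ∀ N₁ → (∀ f → Binary f → Q f × f n ≡ 1 → CoveredWithin N₁ f) →
               ∀ f → Binary f → Q f → ∀ d → f n ≡ d → CoveredWithin (N₀ ⊔ N₁) f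
        glue N₀ h₀ N₁ h₁ f bf q 0 e = weakenBound (m≤m⊔n N₀ N₁) (h₀ f bf (q , e))
        glue N₀ h₀ N₁ h₁ f bf q 1 e = weakenBound (m≤n⊔m N₀ N₁) (h₁ f bf (q , e))
        glue N₀ h₀ N₁ h₁ f bf q (suc (suc d)) e with subst (_< 2) e (bf n)
        ... | s≤s (s≤s ())
      contradictory : ¬ ¬ (∃[ N ] ∀ f → Binary f → CoveredWithin N f)
      contradictory unbounded =
        -- An entry g covering the limit also covers everything agreeing with the limit below G g,
        -- so G g bounds the stage of that number.
        let g , w , _ , c = inChain-covers limit limit-digit in
        proj₂ (stage (G g)) (G g , λ f _ q →
          g , w , ≤-refl , covers-close c (proj₂ (to (stage⇔ (G g) f) q)))
        where
        open Refinement Unbounded (λ _ _ d → d < 2) bisect (λ f → Binary f)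
          (λ (N , h) → unbounded (N , λ f bf → h f bf bf))

    Bounding : Tp 1 → Set
    Bounding g = InChain g × (∀ f → Binary f → CoveredWithin (G g) f)

    -- If no entry has G-value N, the bound N can be lowered by one. The descent stops at the latest
    -- at 0, which is attained by the entry covering the zero function.
    bounding-exists : ∃ Bounding
    bounding-exists = let N , h = compactness in attain N h
      where
      attain : ∀ N → (∀ f → Binary f → CoveredWithin N f) → ∃ Bounding
      attain N h with lem {∃[ g ] InChain g × G g ≡ N}
      attain N h | yes (g , w , refl) = g , w , h
      attain zero h | no none =
        let g , w , Gg≤0 , _ = h (λ _ → 0) (λ _ → s≤s z≤n) in
        ⊥-elim (none (g , w , n≤0⇒n≡0 Gg≤0))
      attain (suc N) h | no none = attain N λ f bf →
        let g , w , Gg≤ , c = h f bf in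
        g , w , ≤-pred (≤∧≢⇒< Gg≤ (λ eq → none (g , w , eq))) , c

    -- Stated through the code i of the prefix f ↾ N, which G g ≤ N makes sufficient.
    Represents : ℕ → ℕ → Tp 1 → Set
    Represents N i g = InChain g × G g ≤ N × (∃[ f ] Binary f × prefixCode f N ≡ i × Covers g f)

    -- The function witnessing the representation shares the first N digits with f, and g inspects
    -- at most N digits.
    represents-covers : ∀ {N f g} → Binary f → Represents N (prefixCode f N) g → Covers g f
    represents-covers {N} binary-f (_ , Gg≤N , f′ , binary-f′ , eq , c) =
      let _ , agree = prefixCode-injective binary-f binary-f′ N N (sym eq) in
      covers-close c (λ k k<n → agree k (<-≤-trans k<n Gg≤N))

-- Defining the chain in the formula language

Gᵗ : ∀ {Δ} → 1 ∈ Δ → Term Δ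
Gᵗ g = apply (there g · var v0)

-- The formulas from here to `leastBoundingᶠ` follow the corresponding predicates clause by clause,
-- so that satisfaction unfolds to them definitionally.
binaryᶠ : ∀ {Δ} → 1 ∈ Δ → Formula Δ
binaryᶠ f = ∀₀ ((there f · var v0) ≺ lit 2)

agreeᶠ : ∀ {Δ} → 1 ∈ Δ → 1 ∈ Δ → Term (0 ∷ Δ) → Formula Δ
agreeᶠ f g n = ∀₀ (var v0 ≺ n ⇒ (there f · var v0) ≈ (there g · var v0))

coversᶠ : ∀ {Δ} → 1 ∈ Δ → 1 ∈ Δ → Formula Δ
coversᶠ g f = agreeᶠ f g (Gᵗ (there g))

infix 8 _⊏ᶠ_

_⊏ᶠ_ : ∀ {Δ} → 1 ∈ Δ → 1 ∈ Δ → Formula Δ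
f ⊏ᶠ g = ∃₀ (agreeᶠ (there f) (there g) (var v1) ∧ (there f · var v0) ≺ (there g · var v0))

rowᶠ : ∀ {Δ} → 1 ∈ Δ → 1 ∈ Δ → Formula Δ
rowᶠ c f = ∃₀ (∀₀ ((there (there f) · var v0) ≈ (there (there c) · pairᵗ (var v1) (var v0))))

chainᶠ : ∀ {Δ} → 1 ∈ Δ → Formula Δ
chainᶠ c = ∀₁ (rowᶠ (there c) v0 ⇒
    binaryᶠ v0
  ∧ ∀₁ (rowᶠ (there (there c)) v0 ⇒ v0 ⊏ᶠ v1 ⇒ ∼ coversᶠ v0 v1)
  ∧ ∀₁ (binaryᶠ v0 ⇒ v0 ⊏ᶠ v1 ⇒
        ∃₁ (rowᶠ (there (there (there c))) v0 ∧ ∼ (v1 ⊏ᶠ v0) ∧ coversᶠ v0 v1)))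

inChainᶠ : ∀ {Δ} → 1 ∈ Δ → Formula Δ
inChainᶠ f = ∃₁ (chainᶠ v0 ∧ rowᶠ v0 (there f))

boundingᶠ : ∀ {Δ} → 1 ∈ Δ → Formula Δ
boundingᶠ g = inChainᶠ g
  ∧ ∀₁ (binaryᶠ v0 ⇒ ∃₁ (inChainᶠ v0 ∧ Gᵗ v0 ≼ Gᵗ (there (there g)) ∧ coversᶠ v0 v1))

leastBoundingᶠ : ∀ {Δ} → Formula (1 ∷ Δ)
leastBoundingᶠ = boundingᶠ v0 ∧ ∀₁ (boundingᶠ v0 ⇒ ∼ (v0 ⊏ᶠ v1))

-- For a formula with a unique solution, which moreover is binary, the truth
-- value that its digit is 0 equals that digit.
digitᵗ : ∀ {Δ} → Formula (1 ∷ Δ) → 0 ∈ Δ → Term Δ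
digitᵗ φ n = truth (∃₁ (φ ∧ (v0 · var (there n)) ≈ lit 0))

boundᵗ : ∀ {Δ} → Term Δ
boundᵗ = apply (digitᵗ leastBoundingᶠ v0)

representsᶠ : ∀ {Δ} → 0 ∈ Δ → 1 ∈ Δ → Formula Δ
representsᶠ i g = inChainᶠ g ∧ Gᵗ g ≼ boundᵗ
  ∧ ∃₁ (binaryᶠ v0 ∧ prefixCodeᵗ v0 boundᵗ ≈ var (there i) ∧ coversᶠ (there g) v0)

leastRepresentsᶠ : ∀ {Δ} → 0 ∈ Δ → Formula (1 ∷ Δ)
leastRepresentsᶠ i =
  representsᶠ (there i) v0 ∧ ∀₁ (representsᶠ (there (there i)) v0 ⇒ ∼ (v0 ⊏ᶠ v1))

entryᵗ : Term (0 ∷ 0 ∷ [])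
entryᵗ = digitᵗ (leastRepresentsᶠ v0) v1

-- All codes of binary prefixes of length N are below 2^(N+1). A position that is no such code holds
-- the constant function 1, since the search by ∃³ fails there.
lengthᵗ : Term []
lengthᵗ = pow2ᵗ (suc boundᵗ)

-- Correctness of the defining terms and the covering property.

↾-cong : ∀ {f g} n → f agrees g below n → f ↾ n ≡ g ↾ n
↾-cong zero    agree = refl
↾-cong (suc n) agree =
  cong₂ _∷_ (agree 0 (s≤s z≤n)) (↾-cong n (λ k k<n → agree (suc k) (s≤s k<n)))

covers⇒∈[] : ∀ {f g} n → f agrees g below n → f ∈[ g ↾ n ]
covers⇒∈[] {f} {g} n agree =
  trans (cong (f ↾_) (length-applyUpTo g n)) (↾-cong n agree)

module Definability (ext : Extensionality 0ℓ 0ℓ) (lem : ExcludedMiddle 0ℓ)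
                    (∃³ : Tp 3) (is∃³ : IsExists³ ∃³) (G : Tp 2) where
  open Evaluation ∃³ G
  open Satisfaction ∃³ is∃³ G
  open Classical ext lem
  open Chains G

  digit-correct : ∀ {Δ x} (φ : Formula (1 ∷ Δ)) (n : 0 ∈ Δ) (ρ : Args Δ) → Binary x →
                  (∀ g → ⟦ φ ⟧ (g ∷ ρ) ⇔ g ≡ x) → eval (digitᵗ φ n) ρ ≡ x (All.lookup ρ n)
  digit-correct {x = x} φ n ρ binary unique = by-digit _ refl
    where
    ψ : Formula _
    ψ = φ ∧ (v0 · var (there n)) ≈ lit 0
    by-digit : ∀ d → x (All.lookup ρ n) ≡ d → eval (digitᵗ φ n) ρ ≡ x (All.lookup ρ n)
    by-digit zero eq =
      trans (from (truth≡0 (∃₁ ψ) ρ) (x , from (unique x) refl , eq)) (sym eq)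
    -- The exact value 1 comes from the second clause of `IsExists³`.
    by-digit (suc zero) eq = trans (proj₂ is∃³ _ none) (sym eq)
      where
      none : ¬ (∃[ f ] eval (truth ψ) (f ∷ ρ) ≡ 0)
      none (f , e) =
        let sat , f≡0 = to (truth≡0 ψ (f ∷ ρ)) e in
        1+n≢0 (trans (sym eq) (trans (cong (λ h → h (All.lookup ρ n)) (sym (to (unique f) sat))) f≡0))
    by-digit (suc (suc d)) eq with subst (_< 2) eq (binary (All.lookup ρ n))
    ... | s≤s (s≤s ())

  Least : (Tp 1 → Set) → Tp 1 → Set
  Least P x = P x × (∀ f → P f → ¬ (f ⊏ x))

  least-unique : ∀ {P : Tp 1 → Set} {x} → Least P x → ∀ g → Least P g ⇔ g ≡ x
  least-unique {P} {x} (p , min) g = mk⇔ unique (λ { refl → p , min })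
    where
    unique : Least P g → g ≡ x
    unique (p′ , min′) with ⊏-cmp g x
    ... | inj₁ g⊏x        = ⊥-elim (min g p′ g⊏x)
    ... | inj₂ (inj₁ eq)  = eq
    ... | inj₂ (inj₂ x⊏g) = ⊥-elim (min′ x p x⊏g)

  bounder : ∃ (Least Bounding)
  bounder = minimum inChain-chain (λ _ → proj₁) bounding-exists

  bound : ℕ
  bound = G (proj₁ bounder)

  bound-correct : ∀ {Δ} (ρ : Args Δ) → eval boundᵗ ρ ≡ bound
  bound-correct ρ = cong G (ext λ n →
    let x , least-x = bounder in
    digit-correct leastBoundingᶠ v0 (n ∷ ρ)
      (proj₁ (inChain-chain x (proj₁ (proj₁ least-x)))) (least-unique least-x))

  -- Formula and predicate differ only in the bound: `boundᵗ` has the value `bound` by a proved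
  -- equation, not definitionally.
  represents-correct : ∀ {Δ} (i : 0 ∈ Δ) (g : 1 ∈ Δ) (ρ : Args Δ) →
    ⟦ representsᶠ i g ⟧ ρ ⇔ Represents bound (All.lookup ρ i) (All.lookup ρ g)
  represents-correct i g ρ = mk⇔
    (λ (w , le , f , bf , e , c) →
       w , subst (G (All.lookup ρ g) ≤_) (bound-correct ρ) le
         , f , bf , trans (cong (prefixCode f) (sym (bound-correct (f ∷ ρ)))) e , c)
    (λ (w , le , f , bf , e , c) →
       w , subst (G (All.lookup ρ g) ≤_) (sym (bound-correct ρ)) le
         , f , bf , trans (cong (prefixCode f) (bound-correct (f ∷ ρ))) e , c)

  entry : ℕ → Tp 1
  entry i n = eval entryᵗ (i ∷ n ∷ [])

  leastRepresents-correct : ∀ (i n : ℕ) (g : Tp 1) →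
    ⟦ leastRepresentsᶠ v0 ⟧ (g ∷ i ∷ n ∷ []) ⇔ Least (Represents bound i) g
  leastRepresents-correct i n g = mk⇔ forth back
    where
    correct : ⟦ representsᶠ v1 v0 ⟧ (g ∷ i ∷ n ∷ []) ⇔ Represents bound i g
    correct = represents-correct v1 v0 (g ∷ i ∷ n ∷ [])
    correct′ : ∀ f → ⟦ representsᶠ v2 v0 ⟧ (f ∷ g ∷ i ∷ n ∷ []) ⇔ Represents bound i f
    correct′ f = represents-correct v2 v0 (f ∷ g ∷ i ∷ n ∷ [])
    forth : ⟦ leastRepresentsᶠ v0 ⟧ (g ∷ i ∷ n ∷ []) → Least (Represents bound i) g
    forth (r , min) = to correct r , λ f r′ → min f (from (correct′ f) r′)
    back : Least (Represents bound i) g → ⟦ leastRepresentsᶠ v0 ⟧ (g ∷ i ∷ n ∷ [])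
    back (r , min) = from correct r , λ f r′ → min f (to (correct′ f) r′)

  entry-least : ∀ {i x} → Least (Represents bound i) x → x ≡ entry i
  entry-least {i} {x} least-x = ext λ n →
    sym (digit-correct (leastRepresentsᶠ v0) v1 (i ∷ n ∷ []) binary-x (unique n))
    where
    binary-x : Binary x
    binary-x = proj₁ (inChain-chain x (proj₁ (proj₁ least-x)))
    unique : ∀ (n : ℕ) (g : Tp 1) → ⟦ leastRepresentsᶠ v0 ⟧ (g ∷ i ∷ n ∷ []) ⇔ g ≡ x
    unique n g = least-unique least-x g ⇔-∘ leastRepresents-correct i n g

  entry-represents : ∀ i → ∃ (Represents bound i) → Represents bound i (entry i)
  entry-represents i inhabited =
    let x , least-x = minimum inChain-chain (λ _ → proj₁) inhabited in
    subst (Represents bound i) (entry-least least-x) (proj₁ least-x)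

  specialFan : List (Tp 1)
  specialFan = applyUpTo entry (eval lengthᵗ [])

  length-computable : ｛ compile lengthᵗ arg ｝ ∃³ ∷ G ∷ [] ≃ length specialFan
  length-computable =
    subst (｛ compile lengthᵗ arg ｝ ∃³ ∷ G ∷ [] ≃_)
      (sym (length-applyUpTo entry (eval lengthᵗ [])))
      (compile-correct lengthᵗ arg {[]} {[]} (λ _ → refl))

  lookup-computable : ∀ (i : Fin (length specialFan)) (n : Tp 0) →
    ｛ compile entryᵗ arg ｝ ∃³ ∷ G ∷ toℕ i ∷ n ∷ [] ≃ lookup specialFan i n
  lookup-computable i n =
    subst (｛ compile entryᵗ arg ｝ ∃³ ∷ G ∷ toℕ i ∷ n ∷ [] ≃_)
      (cong (λ f → f n) (sym (lookup-applyUpTo entry (eval lengthᵗ []) i)))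
      (compile-correct entryᵗ arg {ρ} {ρ} (λ _ → refl))
    where
    ρ : Args (0 ∷ 0 ∷ [])
    ρ = toℕ i ∷ n ∷ []

  -- The entry at the code of the prefix of f of length `bound` covers f; a representative exists
  -- there because the bounding entry provides a cover of f.
  specialFan-covers : ∀ f → Binary f → Any (λ g → f ∈[ g ↾ G g ]) specialFan
  specialFan-covers f binary =
    let _ , (_ , within) , _ = bounder
        g , w , Gg≤N , c = within f binary
        i = prefixCode f bound
        r = entry-represents i (g , w , Gg≤N , f , binary , refl , c)
        i<length = subst (λ N → i < pow2 (suc N)) (sym (bound-correct []))
                     (prefixCode<pow2 binary bound)
    in applyUpTo⁺ entry {i = i} (covers⇒∈[] (G (entry i)) (represents-covers binary r)) i<length

theorem3p9 : Extensionality 0ℓ 0ℓ → ExcludedMiddle 0ℓ →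
    (∃³ : Tp 3) → IsExists³ ∃³ →
    Σ[ Θ ∈ (Tp 2 → List (Tp 1)) ] (SFF Θ × ComputableFrom ∃³ Θ)
theorem3p9 ext lem ∃³ is∃³ =
  specialFan , specialFan-covers
  -- `compile` mentions neither ∃³ nor G, which makes the indices uniform.
  , (compile lengthᵗ arg , length-computable)
  , (compile entryᵗ arg , lookup-computable)
  where open Definability ext lem ∃³ is∃³
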